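{- For any unimodal range map $\delta$, the partial composition maps $\circ_i$ on $\mathbf{Cl}_\delta$ satisfy, for any $u,v\in\mathsf{Cl}_\delta$ and $1\le i\le|u|$, $$\mathsf{F}_u\circ_i\mathsf{F}_v=\chi_\delta(u\,\square_i\,v)\sum_{w\in[u\,\square_i\,v,\;u\,\blacksquare_i\,v]_{\preccurlyeq}}\mathsf{F}_w .$$
   Context: $\mathbb{N}=\{0,1,2,\dots\}$ and $\mathbb{K}$ is a field of characteristic zero. A range map is a map $\delta:\mathbb{N}\setminus\{0\}\to\mathbb{N}$. It is unimodal if there are no $1\le i_1<i_2<i_3$ with $\delta(i_1)>\delta(i_2)<\delta(i_3)$. For a word $w$ on $\mathbb{N}$, $\ell(w)$ is its length, $w(i)$ its $i$-th letter, $\epsilon$ is the empty word. A $\delta$-cliff is a word $w$ on $\mathbb{N}$ with $0\le w(i)\le\delta(i)$ for all $i$; its size is $|w|:=\ell(w)+1$; $\mathsf{Cl}_\delta$ is the graded set of all $\delta$-cliffs. $\chi_\delta(w):=1$ if $w\in\mathsf{Cl}_\delta$ and $\chi_\delta(w):=0$ otherwise. For words $u,v$ and $1\le i\le|u|$, $u\,\square_i\,v:=u(1)\cdots u(i-1)\;v\;u(i)\cdots u(\ell(u))$. For $\delta$ unimodal, $\mathbf{Cl}_\delta$ is the nonsymmetric operad over $\mathbb{K}$ with basis $\{\mathsf{E}_w:w\in\mathsf{Cl}_\delta\}$ ($\mathsf{E}_w$ of arity $|w|$), partial compositions $\mathsf{E}_u\circ_i\mathsf{E}_v=\chi_\delta(u\,\square_i\,v)\,\mathsf{E}_{u\,\square_i\,v}$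 (that is, $0$ when $u\,\square_i\,v$ is not a $\delta$-cliff), and unit $\mathsf{E}_\epsilon$. Order: for $u,v$ of the same length, $u\preccurlyeq v$ iff $u(j)\le v(j)$ for all $j$; $[u,v]_\preccurlyeq$ is the interval of the poset of $\delta$-cliffs of that length (when $u\,\square_i\,v$ is a $\delta$-cliff, so is $u\,\blacksquare_i\,v$ defined below; when it is not, the right-hand side is read as $0$). Fundamental basis: $\mathsf{F}_w:=\sum_{w'\in\mathsf{Cl}_\delta,\,w\preccurlyeq w'}\mu_\preccurlyeq(w,w')\,\mathsf{E}_{w'}$, where $\mu_\preccurlyeq$ is the Möbius function of the poset $\preccurlyeq$ on $\delta$-cliffs of a given size; equivalently $\mathsf{E}_w=\sum_{w'\in\mathsf{Cl}_\delta,\,w\preccurlyeq w'}\mathsf{F}_{w'}$. Operation $\blacksquare_i$: for $w\in\mathsf{Cl}_\delta$ and $f:\{1,\dots,\ell(w)\}\to\mathbb{N}\setminus\{0\}$, let $\mathrm{m}^f_\delta(w)$ be the word of length $\ell(w)$ with $j$-th letter $\delta(f(j))$ if $w(j)=\delta(j)$, and $w(j)$ otherwise. For $u,v\in\mathsf{Cl}_\delta$ and $1\le i\le|u|$, $u\,\blacksquare_i\,v:=\mathrm{m}^f_\delta(u)\,\square_i\,\mathrm{m}^g_\delta(v)$, where $f(j):=j$ if $j\le i-1$, $f(j):=j+\ell(v)$ otherwise, and $g(j):=j+i-1$. -}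

module Defs where

open import Algebra.Apartness.Bundles using (HeytingField; HeytingCommutativeRing)
open import Algebra.Bundles using (CommutativeRing)
import Algebra.Definitions.RawMonoid as RawMonoidDefs
open import Data.Bool.Base using (if_then_else_)
open import Data.Fin.Base using (Fin; zero; suc; toℕ)
open import Data.Fin.Properties using (all?; toℕ≤pred[n])
open import Data.Integer.Base as ℤ using (ℤ; +_; -[1+_]; 0ℤ; 1ℤ)
open import Data.Irrelevant using ([_])
import Data.Irrelevant as Irrelevant
open import Data.List.Base as List
  using (List; foldr; filter; allFin; cartesianProductWith)
open import Data.Nat.Base using (ℕ; zero; suc; _+_; _≤_; _<_; _>_)
open import Data.Nat.Induction using (<-wellFounded)
import Data.Nat.Properties as ℕ
open import Data.Product.Base using (∃-syntax; _×_; _,_)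
open import Data.Refinement using (Refinement-syntax; value; _,_)
open import Data.Vec.Base using (Vec; []; _∷_; _++_; cast; lookup; tabulate; sum)
open import Data.Vec.Properties using (≡-dec)
open import Data.Vec.Relation.Binary.Pointwise.Inductive as Pointwise
  using (Pointwise; []; _∷_)
open import Induction.WellFounded using (WellFounded; Acc; acc; module Subrelation)
open import Level using (Level; _⊔_; 0ℓ)
open import Relation.Binary.Bundles using (DecPoset)
open import Relation.Binary.Core using (Rel)
open import Relation.Binary.Definitions using (Decidable)
import Relation.Binary.Construct.NonStrictToStrict as Strict
import Relation.Binary.Construct.On as On
open import Relation.Binary.PropositionalEquality
  using (_≡_; _≢_; refl; cong; cong₂; isEquivalence)
open import Relation.Binary.Structures using (IsDecPartialOrder)
open import Relation.Nullary using (¬_; Dec; yes; no; does; contradiction)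
open import Relation.Nullary.Decidable using (_×-dec_)

private
  variable
    ℓ m n : ℕ

-- Mathematically, range maps are maps ℕ∖{0} → ℕ and letters of words are numbered
-- from 1; here both are shifted down by one: δ k stands for δ(k+1), lookup w k for w(k+1).
RangeMap : Set
RangeMap = ℕ → ℕ

Unimodal : RangeMap → Set
Unimodal δ =
  ¬ (∃[ i ] ∃[ j ] ∃[ k ] (i < j × j < k × δ i > δ j × δ j < δ k))

Word : ℕ → Set
Word ℓ = Vec ℕ ℓ

-- A word u of length m has size m + 1.  An element i of Fin (suc m) stands for
-- the insertion position i + 1, where 1 ≤ i + 1 ≤ |u|.
infix 8 _□⟨_⟩_ _■⟨_,_⟩_

_□⟨_⟩_ : Word m → Fin (suc m) → Word n → Word (m + n)
_□⟨_⟩_ {m} {n} u zero v = cast (ℕ.+-comm n m) (v ++ u)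
(a ∷ u) □⟨ suc i ⟩ v = a ∷ (u □⟨ i ⟩ v)

saturate : RangeMap → (Fin ℓ → ℕ) → Word ℓ → Word ℓ
saturate δ f w = tabulate λ j →
  if does (lookup w j ℕ.≟ δ (toℕ j)) then δ (f j) else lookup w j

-- Since positions are shifted by one, j ≤ i - 1 becomes j < i, and the map
-- j ↦ j + i - 1 becomes j ↦ j + i.
_■⟨_,_⟩_ : Word m → RangeMap → Fin (suc m) → Word n → Word (m + n)
_■⟨_,_⟩_ {m} {n} u δ i v = saturate δ f u □⟨ i ⟩ saturate δ g v
  where
  f : Fin m → ℕ
  f j = if does (toℕ j ℕ.<? toℕ i) then toℕ j else toℕ j + n
  g : Fin n → ℕ
  g j = toℕ j + toℕ i

infix 4 _≼_ _≼?_

_≼_ : Rel (Word ℓ) 0ℓ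
_≼_ = Pointwise _≤_

_≼?_ : Decidable (_≼_ {ℓ})
_≼?_ = Pointwise.decidable ℕ._≤?_

≼-isDecPartialOrder : IsDecPartialOrder _≡_ (_≼_ {ℓ})
≼-isDecPartialOrder = record
  { isPartialOrder = record
    { isPreorder = record
      { isEquivalence = isEquivalence
      ; reflexive     = λ { refl → Pointwise.refl ℕ.≤-refl }
      ; trans         = Pointwise.trans ℕ.≤-trans
      }
    ; antisym = antisym
    }
  ; _≟_  = ≡-dec ℕ._≟_
  ; _≤?_ = _≼?_
  }
  where
  antisym : {x y : Word ℓ} → x ≼ y → y ≼ x → x ≡ y
  antisym []       []       = refl
  antisym (p ∷ ps) (q ∷ qs) = cong₂ _∷_ (ℕ.≤-antisym p q) (antisym ps qs)

≺-wellFounded : WellFounded (Strict._<_ _≡_ (_≼_ {ℓ}))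
≺-wellFounded =
  Subrelation.wellFounded (λ (p , ≢) → sum-strict p ≢) (On.wellFounded sum <-wellFounded)
  where
  sum-mono : {x y : Word ℓ} → x ≼ y → sum x ≤ sum y
  sum-mono []       = ℕ.≤-refl
  sum-mono (p ∷ ps) = ℕ.+-mono-≤ p (sum-mono ps)

  sum-strict : {x y : Word ℓ} → x ≼ y → x ≢ y → sum x < sum y
  sum-strict [] ≢ = contradiction refl ≢
  sum-strict {x = a ∷ _} {b ∷ _} (p ∷ ps) ≢ with a ℕ.≟ b
  ... | yes refl = ℕ.+-monoʳ-< a (sum-strict ps λ eq → ≢ (cong (a ∷_) eq))
  ... | no  a≢b  = ℕ.+-mono-<-≤ (ℕ.≤∧≢⇒< p a≢b) (sum-mono ps)

IsCliff : RangeMap → Word ℓ → Set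
IsCliff δ w = ∀ j → lookup w j ≤ δ (toℕ j)

isCliff? : (δ : RangeMap) (w : Word ℓ) → Dec (IsCliff δ w)
isCliff? δ w = all? λ j → lookup w j ℕ.≤? δ (toℕ j)

-- The δ-cliffs of length ℓ, that is, of size ℓ + 1.
Cl : RangeMap → ℕ → Set
Cl δ ℓ = [ w ∈ Word ℓ ∣ IsCliff δ w ]

cliffs : (δ : RangeMap) (ℓ : ℕ) → List (Cl δ ℓ)
cliffs δ zero    = List.[ [] , [ (λ ()) ] ]
cliffs δ (suc ℓ) =
  cartesianProductWith cons (allFin (suc (δ 0))) (cliffs (λ k → δ (suc k)) ℓ)
  where
  cons : Fin (suc (δ 0)) → Cl (λ k → δ (suc k)) ℓ → Cl δ (suc ℓ)
  cons a (w , p) = toℕ a ∷ w , Irrelevant.map consIsCliff p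
    where
    consIsCliff : IsCliff (λ k → δ (suc k)) w → IsCliff δ (toℕ a ∷ w)
    consIsCliff q zero    = toℕ≤pred[n] a
    consIsCliff q (suc j) = q j

cliffPoset : RangeMap → ℕ → DecPoset 0ℓ 0ℓ 0ℓ
cliffPoset δ ℓ = record
  { Carrier           = Cl δ ℓ
  ; isDecPartialOrder = On.isDecPartialOrder value ≼-isDecPartialOrder
  }

-- The endpoints are arbitrary words, so that the interval is meaningful without
-- a proof that they are cliffs; its elements are cliffs in every case.
interval : (δ : RangeMap) → Word ℓ → Word ℓ → List (Cl δ ℓ)
interval δ x y = filter (λ w → (x ≼? value w) ×-dec (value w ≼? y)) (cliffs δ _)

-- The Möbius function of a finite poset: μ x x = 1, and
-- μ x y = - Σ_{x ≤ z < y} μ x z otherwise (hence μ x y = 0 unless x ≤ y).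
-- The list must contain each element of the poset exactly once.

module Möbius {a ℓ₁ ℓ₂ : Level} (P : DecPoset a ℓ₁ ℓ₂)
              (elements : List (DecPoset.Carrier P))
              (<-wf : WellFounded (Strict._<_ (DecPoset._≈_ P) (DecPoset._≤_ P)))
              where
  private
    module P = DecPoset P
    _⊏_ : Rel P.Carrier (ℓ₁ ⊔ ℓ₂)
    _⊏_ = Strict._<_ P._≈_ P._≤_
    _⊏?_ : Decidable _⊏_
    _⊏?_ = Strict.<-decidable P._≈_ P._≤_ P._≟_ P._≤?_

  μ-acc : P.Carrier → (y : P.Carrier) → Acc _⊏_ y → ℤ
  μ-acc x y (acc rs) =
    if does (x P.≟ y)
    then 1ℤ
    else ℤ.- foldr (λ z s → term z ((x P.≤? z) ×-dec (z ⊏? y)) ℤ.+ s) 0ℤ elements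
    where
    term : (z : P.Carrier) → Dec (x P.≤ z × z ⊏ y) → ℤ
    term z (yes (_ , z⊏y)) = μ-acc x z (rs z⊏y)
    term z (no _)          = 0ℤ

  μ : P.Carrier → P.Carrier → ℤ
  μ x y = μ-acc x y (<-wf y)

μ≼ : (δ : RangeMap) → Cl δ ℓ → Cl δ ℓ → ℤ
μ≼ {ℓ} δ =
  Möbius.μ (cliffPoset δ ℓ) (cliffs δ ℓ) (On.wellFounded value ≺-wellFounded)

-- Classically, a Heyting field is exactly a field, with _#_ being _≉_.
module FieldDefs {c ℓ₁ ℓ₂ : Level} (K : HeytingField c ℓ₁ ℓ₂) where
  open HeytingField K public using (Carrier; _≈_; 0#; 1#)
  private
    R : CommutativeRing c ℓ₁
    R = HeytingCommutativeRing.commutativeRing (HeytingField.heytingCommutativeRing K)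
  open CommutativeRing R public
    using () renaming (_+_ to _+ᴷ_; _*_ to _*ᴷ_; -_ to -ᴷ_)
  open RawMonoidDefs (CommutativeRing.+-rawMonoid R) public
    using () renaming (_×_ to _×ᴷ_)

  fromℤ : ℤ → Carrier
  fromℤ (+ n)    = n ×ᴷ 1#
  fromℤ -[1+ n ] = -ᴷ (suc n ×ᴷ 1#)

CharacteristicZero : {c ℓ₁ ℓ₂ : Level} → HeytingField c ℓ₁ ℓ₂ → Set ℓ₁
CharacteristicZero K = ∀ n → ¬ (suc n ×ᴷ 1# ≈ 0#)
  where open FieldDefs K

module CliffOperad {c ℓ₁ ℓ₂ : Level} (K : HeytingField c ℓ₁ ℓ₂) (δ : RangeMap) where
  open FieldDefs K

  -- Op ℓ is the component of arity ℓ + 1, spanned by the finitely many δ-cliffs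
  -- of length ℓ; an element is given by its coefficients on the basis E.
  Op : ℕ → Set c
  Op ℓ = Cl δ ℓ → Carrier

  infix  4 _≋_
  infix  8 _∘⟨_⟩_
  infixl 6 _⊕_
  infixr 7 _·_

  _≋_ : Rel (Op ℓ) ℓ₁
  x ≋ y = ∀ w → x w ≈ y w

  𝟘 : Op ℓ
  𝟘 _ = 0#

  _⊕_ : Op ℓ → Op ℓ → Op ℓ
  (x ⊕ y) w = x w +ᴷ y w

  _·_ : Carrier → Op ℓ → Op ℓ
  (k · x) w = k *ᴷ x w

  ∑ : {a : Level} {A : Set a} → List A → (A → Op ℓ) → Op ℓ
  ∑ as f = foldr (λ a s → f a ⊕ s) 𝟘 as

  E : Cl δ ℓ → Op ℓ
  E w w′ = if does (≡-dec ℕ._≟_ (value w) (value w′)) then 1# else 0#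

  χ : Word ℓ → Carrier
  χ w = if does (isCliff? δ w) then 1# else 0#

  E∘ : Cl δ m → Fin (suc m) → Cl δ n → Op (m + n)
  E∘ u i v with isCliff? δ (value u □⟨ i ⟩ value v)
  ... | yes p = E (value u □⟨ i ⟩ value v , [ p ])
  ... | no  _ = 𝟘

  -- The bilinear extension of E∘.
  _∘⟨_⟩_ : Op m → Fin (suc m) → Op n → Op (m + n)
  x ∘⟨ i ⟩ y = ∑ (cliffs δ _) λ u → ∑ (cliffs δ _) λ v → (x u *ᴷ y v) · E∘ u i v

  F : Cl δ ℓ → Op ℓ
  F w = ∑ (filter (λ w′ → value w ≼? value w′) (cliffs δ _))
          λ w′ → fromℤ (μ≼ δ w w′) · E w′

{-# OPTIONS --safe #-}

-- Let ζ x y be the sum of the coefficients of x over the cliffs z ≼ y.  This transform is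
-- injective, and by Möbius inversion it sends F w to the indicator of w.  A cliff y lies above
-- u □⟨ i ⟩ v exactly when its outer part (the positions occupied by u) lies above u and its
-- inner part lies above v, once these parts are truncated by δ to become cliffs.  Hence ζ turns
-- ∘⟨ i ⟩ into a product, and ζ (F u ∘⟨ i ⟩ F v) y = 1 exactly when u and v are the truncated
-- parts of y.  Letter by letter, a = min (b , δ d) with a ≤ δ d and b ≤ δ e means a ≤ b ≤ δ e
-- if a = δ d, and a = b otherwise; that is, y lies between u □⟨ i ⟩ v and u ■⟨ δ , i ⟩ v.
module Submission where

open import Defs
open import Algebra.Apartness.Bundles using (HeytingField; HeytingCommutativeRing)
open import Algebra.Bundles using (CommutativeRing)
import Algebra.Properties.CommutativeSemigroup as CommutativeSemigroupProperties
import Algebra.Properties.Monoid.Mult as MonoidMult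
import Algebra.Properties.Ring as RingProperties
open import Data.Bool.Base using (if_then_else_)
open import Data.Bool.Properties using (if-float)
open import Data.Fin.Base as Fin using (Fin; zero; suc; toℕ; fromℕ<; _↑ˡ_; _↑ʳ_; splitAt)
import Data.Fin.Properties as Fin
open import Data.Integer.Base as ℤ using (ℤ; +_; -[1+_]; 0ℤ; 1ℤ)
import Data.Integer.Properties as ℤ
open import Data.Irrelevant using ([_])
open import Data.List.Base using (List; []; _∷_; foldr; filter)
open import Data.List.Properties using (foldr-cong)
open import Data.List.Membership.Propositional using (_∈_)
open import Data.List.Membership.Propositional.Properties using (∈-allFin; ∈-cartesianProductWith⁺)
open import Data.List.Relation.Unary.All as All using (All; []; _∷_)
open import Data.List.Relation.Unary.Any using (here; there)
open import Data.List.Relation.Unary.Unique.Propositional using (Unique; []; _∷_)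
import Data.List.Relation.Unary.Unique.Propositional.Properties as Unique
open import Data.Nat.Base using (ℕ; zero; suc; _+_; _≤_; _⊓_; s≤s)
import Data.Nat.Properties as ℕ
open import Data.Product.Base using (Σ-syntax; _×_; _,_; proj₁; proj₂)
open import Data.Refinement using (value; value-injective; _,_)
open import Data.Sum.Base using (inj₁; inj₂)
open import Data.Vec.Base using (Vec; []; _∷_; _++_; lookup; tabulate)
open import Data.Vec.Properties
  using (≡-dec; ∷-injective; lookup∘tabulate; tabulate∘lookup; tabulate-cong;
         lookup-cast; lookup-++ˡ; lookup-++ʳ)
import Data.Vec.Relation.Binary.Pointwise.Extensional as Extensional
import Data.Vec.Relation.Binary.Pointwise.Inductive as Pointwise
open import Function.Base using (_∘_)
open import Function.Bundles using (_⇔_; mk⇔; Equivalence)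
open import Induction.WellFounded using (Acc; acc; WellFounded)
open import Level using (Level)
open import Relation.Binary.Bundles using (DecPoset)
import Relation.Binary.Construct.NonStrictToStrict as Strict
import Relation.Binary.Construct.On as On
open import Relation.Binary.PropositionalEquality
  using (_≡_; refl; sym; trans; cong; subst)
open import Relation.Nullary using (¬_; Dec; yes; no; does; contradiction)
open import Relation.Nullary.Decidable using (_×-dec_; does-⇔; recompute; dec-true; dec-false)
import Relation.Unary as U

private
  variable
    a p q : Level
    A : Set a
    k m n : ℕ

-- Words letter by letter, and the positions of an insertion.

≼-ext : {x y : Word k} → (∀ j → lookup x j ≤ lookup y j) → x ≼ y
≼-ext h = Extensional.extensional⇒inductive (Extensional.ext h)

lookup-injective : {x y : Vec A k} → (∀ j → lookup x j ≡ lookup y j) → x ≡ y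
lookup-injective {x = x} {y} h =
  trans (sym (tabulate∘lookup x)) (trans (tabulate-cong h) (tabulate∘lookup y))

-- The position in u □⟨ i ⟩ v of a letter of u, respectively of v.
outer : Fin (suc m) → (n : ℕ) → Fin m → Fin (m + n)
outer {m} zero n j = Fin.cast (ℕ.+-comm n m) (n ↑ʳ j)
outer (suc i) n zero = zero
outer (suc i) n (suc j) = suc (outer i n j)

inner : Fin (suc m) → Fin n → Fin (m + n)
inner {m} {n} zero j = Fin.cast (ℕ.+-comm n m) (j ↑ˡ m)
inner {suc m} (suc i) j = suc (inner i j)

lookup-outer : (u : Word m) (i : Fin (suc m)) (v : Word n) (j : Fin m) →
               lookup (u □⟨ i ⟩ v) (outer i n j) ≡ lookup u j
lookup-outer {m} {n} u zero v j =
  trans (lookup-cast (ℕ.+-comm n m) (v ++ u) (n ↑ʳ j)) (lookup-++ʳ v u j)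
lookup-outer (a ∷ u) (suc i) v zero = refl
lookup-outer (a ∷ u) (suc i) v (suc j) = lookup-outer u i v j

lookup-inner : (u : Word m) (i : Fin (suc m)) (v : Word n) (j : Fin n) →
               lookup (u □⟨ i ⟩ v) (inner i j) ≡ lookup v j
lookup-inner {m} {n} u zero v j =
  trans (lookup-cast (ℕ.+-comm n m) (v ++ u) (j ↑ˡ m)) (lookup-++ˡ v u j)
lookup-inner (a ∷ u) (suc i) v j = lookup-inner u i v j

-- The right-hand side is the local function `f` of `_■⟨_,_⟩_`: saturation of a letter uses the
-- range at the position to which the letter moves. For `toℕ-inner` it is the local function `g`.
toℕ-outer : (i : Fin (suc m)) (j : Fin m) →
            toℕ (outer i n j) ≡ (if does (toℕ j ℕ.<? toℕ i) then toℕ j else toℕ j + n)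
toℕ-outer {m} {n} zero j =
  trans (Fin.toℕ-cast (ℕ.+-comm n m) (n ↑ʳ j)) (trans (Fin.toℕ-↑ʳ n j) (ℕ.+-comm n (toℕ j)))
toℕ-outer (suc i) zero = refl
toℕ-outer (suc i) (suc j) =
  trans (cong suc (toℕ-outer i j)) (if-float suc (does (toℕ j ℕ.<? toℕ i)))

toℕ-inner : (i : Fin (suc m)) (j : Fin n) → toℕ (inner i j) ≡ toℕ j + toℕ i
toℕ-inner {m} {n} zero j =
  trans (Fin.toℕ-cast (ℕ.+-comm n m) (j ↑ˡ m))
        (trans (Fin.toℕ-↑ˡ j m) (sym (ℕ.+-identityʳ (toℕ j))))
toℕ-inner {suc m} (suc i) j = trans (cong suc (toℕ-inner i j)) (sym (ℕ.+-suc (toℕ j) (toℕ i)))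

outer∨inner : (i : Fin (suc m)) (P : Fin (m + n) → Set p) →
              (∀ j → P (outer i n j)) → (∀ j → P (inner i j)) → ∀ k → P k
outer∨inner {m} {n} zero P po pi k =
  -- At position `zero` the letters of `v` come first, so the split takes place in `n + m`; `k` is
  -- cast there and back.
  subst P (Fin.cast-involutive (ℕ.+-comm n m) (ℕ.+-comm m n) k) (go (Fin.cast (ℕ.+-comm m n) k))
  where
  go : ∀ k → P (Fin.cast (ℕ.+-comm n m) k)
  go k with splitAt n k in eq
  ... | inj₁ j = subst (P ∘ Fin.cast _) (Fin.splitAt⁻¹-↑ˡ eq) (pi j)
  ... | inj₂ j = subst (P ∘ Fin.cast _) (Fin.splitAt⁻¹-↑ʳ eq) (po j)
outer∨inner {suc m} (suc i) P po pi zero = po zero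
outer∨inner {suc m} (suc i) P po pi (suc k) = outer∨inner i (P ∘ suc) (po ∘ suc) pi k

-- Truncation to cliffs, and the interval from insertion to saturated insertion.

isCliff : (δ : RangeMap) (w : Cl δ k) → IsCliff δ (value w)
-- The stored proof is irrelevant; deciding the property again yields a usable one.
isCliff δ (w , [ c ]) = recompute (isCliff? δ w) c

≼-cliff : (δ : RangeMap) {x y : Word k} → x ≼ y → IsCliff δ y → IsCliff δ x
≼-cliff δ x≼y c j = ℕ.≤-trans (Pointwise.lookup x≼y j) (c j)

module _ (δ : RangeMap) where

  truncate : (Fin m → Fin n) → Word n → Cl δ m
  truncate f y =
    tabulate (λ j → lookup y (f j) ⊓ δ (toℕ j)) ,
    [ (λ j → subst (_≤ δ (toℕ j)) (sym (lookup∘tabulate _ j)) (ℕ.m⊓n≤n _ (δ (toℕ j)))) ]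

  -- A cliff already stays below `δ`, so taking the minimum with `δ` does not change which cliffs
  -- lie below: the truncation is the largest cliff under the subword that `f` selects.
  ≼-truncate : (f : Fin m → Fin n) (x : Cl δ m) (y : Word n) →
               value x ≼ value (truncate f y) ⇔ (∀ j → lookup (value x) j ≤ lookup y (f j))
  ≼-truncate f x y = mk⇔
    (λ le j → ℕ.≤-trans (subst (_ ≤_) (lookup∘tabulate _ j) (Pointwise.lookup le j)) (ℕ.m⊓n≤m _ _))
    (λ h → ≼-ext λ j → subst (_ ≤_) (sym (lookup∘tabulate _ j)) (ℕ.⊓-glb (h j) (isCliff δ x j)))

  -- Every position is outer or inner and carries a letter of `u` or of `v` accordingly, so the
  -- comparison splits into two independent ones.
  □-≼ : (u : Cl δ m) (i : Fin (suc m)) (v : Cl δ n) (y : Word (m + n)) →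
        (value u □⟨ i ⟩ value v ≼ y) ⇔
        (value u ≼ value (truncate (outer i n) y) × value v ≼ value (truncate (inner i) y))
  □-≼ {m} {n} u i v y = mk⇔
    (λ le → Equivalence.from (≼-truncate (outer i n) u y)
              (λ j → subst (_≤ _) (lookup-outer (value u) i (value v) j)
                       (Pointwise.lookup le (outer i n j)))
          , Equivalence.from (≼-truncate (inner i) v y)
              (λ j → subst (_≤ _) (lookup-inner (value u) i (value v) j)
                       (Pointwise.lookup le (inner i j))))
    (λ (uo , vi) → ≼-ext (outer∨inner i _
       (λ j → subst (_≤ _) (sym (lookup-outer (value u) i (value v) j))
                (Equivalence.to (≼-truncate (outer i n) u y) uo j))
       (λ j → subst (_≤ _) (sym (lookup-inner (value u) i (value v) j))
                (Equivalence.to (≼-truncate (inner i) v y) vi j))))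

  -- One letter of `saturate`: `d` is the position that the letter leaves, `e` the one it moves to.
  saturated : ℕ → ℕ → ℕ → ℕ
  saturated x d e = if does (x ℕ.≟ δ d) then δ e else x

  -- If `x` is `δ d`, the equation only says that `y` reaches `δ d`, and `y ≤ δ e` is given.
  -- Otherwise the minimum cannot be `δ d`, hence it is `y`.
  ≡-⊓⇔saturated : ∀ {x y} d e → x ≤ δ d → y ≤ δ e → x ≡ y ⊓ δ d ⇔ (x ≤ y × y ≤ saturated x d e)
  ≡-⊓⇔saturated {x} {y} d e x≤d y≤e = go (x ℕ.≟ δ d)
    where
    -- With the decision as an argument, the conditional hidden in `saturated` reduces in each case.
    go : (x≟d : Dec (x ≡ δ d)) →
         x ≡ y ⊓ δ d ⇔ (x ≤ y × y ≤ (if does x≟d then δ e else x))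
    go (yes refl) = mk⇔
      (λ eq → subst (_≤ y) (sym eq) (ℕ.m⊓n≤m y x) , y≤e)
      (λ (x≤y , _) → sym (ℕ.m≥n⇒m⊓n≡n x≤y))
    go (no x≢d) = mk⇔ to (λ (x≤y , y≤x) → trans (ℕ.≤-antisym x≤y y≤x)
      (sym (ℕ.m≤n⇒m⊓n≡m (ℕ.≤-trans y≤x x≤d))))
      where
      to : x ≡ y ⊓ δ d → x ≤ y × y ≤ x
      to eq with ℕ.≤-total y (δ d)
      ... | inj₁ y≤d = ℕ.≤-reflexive x≡y , ℕ.≤-reflexive (sym x≡y)
        where x≡y = trans eq (ℕ.m≤n⇒m⊓n≡m y≤d)
      ... | inj₂ d≤y = contradiction (trans eq (ℕ.m≥n⇒m⊓n≡n d≤y)) x≢d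

  lookup-■-outer : (u : Word m) (i : Fin (suc m)) (v : Word n) (j : Fin m) →
                   lookup (u ■⟨ δ , i ⟩ v) (outer i n j) ≡
                   saturated (lookup u j) (toℕ j) (toℕ (outer i n j))
  lookup-■-outer {n = n} u i v j =
    trans (lookup-outer _ i _ j)
    (trans (lookup∘tabulate _ j)
           (cong (saturated (lookup u j) (toℕ j)) (sym (toℕ-outer {n = n} i j))))

  lookup-■-inner : (u : Word m) (i : Fin (suc m)) (v : Word n) (j : Fin n) →
                   lookup (u ■⟨ δ , i ⟩ v) (inner i j) ≡
                   saturated (lookup v j) (toℕ j) (toℕ (inner i j))
  lookup-■-inner u i v j =
    trans (lookup-inner _ i _ j)
    (trans (lookup∘tabulate _ j)
           (cong (saturated (lookup v j) (toℕ j)) (sym (toℕ-inner i j))))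

  -- `≡-⊓⇔saturated` applies at each position, with `d` the old and `e` the new place of a letter;
  -- the bound by `δ e` holds because `y` is a cliff.
  ≡-truncate⇔∈interval :
    (u : Cl δ m) (i : Fin (suc m)) (v : Cl δ n) (y : Cl δ (m + n)) →
    (value u ≡ value (truncate (outer i n) (value y)) ×
     value v ≡ value (truncate (inner i) (value y)))
    ⇔ (value u □⟨ i ⟩ value v ≼ value y × value y ≼ value u ■⟨ δ , i ⟩ value v)
  ≡-truncate⇔∈interval {m} {n} u@(u′ , _) i v@(v′ , _) y@(y′ , _) = mk⇔ to from
    where
    outer⇔ : ∀ j → _
    outer⇔ j = ≡-⊓⇔saturated (toℕ j) (toℕ (outer i n j)) (isCliff δ u j) (isCliff δ y (outer i n j))
    inner⇔ : ∀ j → _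
    inner⇔ j = ≡-⊓⇔saturated (toℕ j) (toℕ (inner i j)) (isCliff δ v j) (isCliff δ y (inner i j))
    to : _
    to (u≡ , v≡) =
        ≼-ext (outer∨inner i _
          (λ j → subst (_≤ _) (sym (lookup-outer u′ i v′ j)) (proj₁ (o j)))
          (λ j → subst (_≤ _) (sym (lookup-inner u′ i v′ j)) (proj₁ (ι j))))
      , ≼-ext (outer∨inner i _
          (λ j → subst (_ ≤_) (sym (lookup-■-outer u′ i v′ j)) (proj₂ (o j)))
          (λ j → subst (_ ≤_) (sym (lookup-■-inner u′ i v′ j)) (proj₂ (ι j))))
      where
      o : ∀ j → _
      o j = Equivalence.to (outer⇔ j) (trans (cong (λ w → lookup w j) u≡) (lookup∘tabulate _ j))
      ι : ∀ j → _
      ι j = Equivalence.to (inner⇔ j) (trans (cong (λ w → lookup w j) v≡) (lookup∘tabulate _ j))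
    from : _
    from (lo , hi) =
        lookup-injective (λ j → trans
          (Equivalence.from (outer⇔ j)
            ( subst (_≤ _) (lookup-outer u′ i v′ j) (Pointwise.lookup lo (outer i n j))
            , subst (_ ≤_) (lookup-■-outer u′ i v′ j) (Pointwise.lookup hi (outer i n j))))
          (sym (lookup∘tabulate _ j)))
      , lookup-injective (λ j → trans
          (Equivalence.from (inner⇔ j)
            ( subst (_≤ _) (lookup-inner u′ i v′ j) (Pointwise.lookup lo (inner i j))
            , subst (_ ≤_) (lookup-■-inner u′ i v′ j) (Pointwise.lookup hi (inner i j))))
          (sym (lookup∘tabulate _ j)))

-- The list of cliffs contains each cliff exactly once.

cliffs-unique : (δ : RangeMap) (k : ℕ) → Unique (cliffs δ k)
cliffs-unique δ zero    = [] ∷ []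
cliffs-unique δ (suc k) =
  Unique.cartesianProductWith⁺ _
    (λ eq → let head≡ , tail≡ = ∷-injective (cong value eq)
            in Fin.toℕ-injective head≡ , value-injective tail≡)
    (Unique.allFin⁺ (suc (δ 0))) (cliffs-unique _ k)

∈-cliffs : (δ : RangeMap) (w : Cl δ k) → w ∈ cliffs δ k
∈-cliffs δ ([] , _) = here refl
∈-cliffs δ (x ∷ w , [ c ]) =
  -- The enumeration produces the head as `toℕ (fromℕ< _)`, equal to `x` only propositionally; equal
  -- values suffice because cliff proofs are irrelevant.
  subst (_∈ cliffs δ _) (value-injective (cong (_∷ w) (Fin.toℕ-fromℕ< (s≤s x≤δ))))
    (∈-cartesianProductWith⁺ _ (∈-allFin (fromℕ< (s≤s x≤δ))) (∈-cliffs _ (w , [ c ∘ suc ])))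
  where
  x≤δ : x ≤ δ 0
  x≤δ = isCliff δ (x ∷ w , [ c ]) zero

-- Finite sums and indicators in a commutative ring.

module IndicatorSums {c ℓ} (R : CommutativeRing c ℓ) where
  open CommutativeRing R
    renaming (Carrier to K; _+_ to _+ᴷ_; _*_ to _*ᴷ_;
              refl to ≈-refl; sym to ≈-sym; trans to ≈-trans)
  open CommutativeSemigroupProperties +-commutativeSemigroup
    using () renaming (interchange to +-interchange)

  -- Built from `does`, so that `χ` and the coefficients of `E` are indicators by definition.
  𝟙 : {P : Set p} → Dec P → K
  𝟙 P? = if does P? then 1# else 0#

  𝟙-true : {P : Set p} (P? : Dec P) → P → 𝟙 P? ≈ 1#
  𝟙-true P? x rewrite dec-true P? x = ≈-refl

  𝟙-false : {P : Set p} (P? : Dec P) → ¬ P → 𝟙 P? ≈ 0#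
  𝟙-false P? ¬x rewrite dec-false P? ¬x = ≈-refl

  𝟙-⇔ : {P : Set p} {Q : Set q} → P ⇔ Q → (P? : Dec P) (Q? : Dec Q) → 𝟙 P? ≈ 𝟙 Q?
  𝟙-⇔ P⇔Q P? Q? = reflexive (cong (if_then 1# else 0#) (does-⇔ P⇔Q P? Q?))

  𝟙-× : {P : Set p} {Q : Set q} (P? : Dec P) (Q? : Dec Q) → 𝟙 P? *ᴷ 𝟙 Q? ≈ 𝟙 (P? ×-dec Q?)
  𝟙-× (yes _) Q? = *-identityˡ _
  𝟙-× (no _)  Q? = zeroˡ _

  𝟙-zeroˡ : {P : Set p} (P? : Dec P) {x : K} → ¬ P → 𝟙 P? *ᴷ x ≈ 0#
  𝟙-zeroˡ P? ¬x = ≈-trans (*-congʳ (𝟙-false P? ¬x)) (zeroˡ _)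

  𝟙-identityˡ : {P : Set p} (P? : Dec P) {x : K} → P → 𝟙 P? *ᴷ x ≈ x
  𝟙-identityˡ P? h = ≈-trans (*-congʳ (𝟙-true P? h)) (*-identityˡ _)

  -- Where `P` fails both sides vanish. Thus an equation known only under `P`, such as an induction
  -- hypothesis, can be used inside a sum.
  𝟙-congˡ : {P : Set p} (P? : Dec P) {x y : K} → (P → x ≈ y) → 𝟙 P? *ᴷ x ≈ 𝟙 P? *ᴷ y
  𝟙-congˡ (yes p) x≈y = *-congˡ (x≈y p)
  𝟙-congˡ (no _)  _   = ≈-trans (zeroˡ _) (≈-sym (zeroˡ _))

  sumOf : List A → (A → K) → K
  sumOf as f = foldr (λ a s → f a +ᴷ s) 0# as

  sumOf-cong : (as : List A) {f g : A → K} → (∀ a → f a ≈ g a) → sumOf as f ≈ sumOf as g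
  sumOf-cong []       f≈g = ≈-refl
  sumOf-cong (a ∷ as) f≈g = +-cong (f≈g a) (sumOf-cong as f≈g)

  sumOf-zero : (as : List A) {f : A → K} → (∀ a → f a ≈ 0#) → sumOf as f ≈ 0#
  sumOf-zero []       f≈0 = ≈-refl
  sumOf-zero (a ∷ as) f≈0 = ≈-trans (+-cong (f≈0 a) (sumOf-zero as f≈0)) (+-identityˡ 0#)

  sumOf-+ : (as : List A) (f g : A → K) →
            sumOf as (λ a → f a +ᴷ g a) ≈ sumOf as f +ᴷ sumOf as g
  sumOf-+ []       f g = ≈-sym (+-identityˡ 0#)
  sumOf-+ (a ∷ as) f g = ≈-trans (+-congˡ (sumOf-+ as f g)) (+-interchange _ _ _ _)

  *-distribˡ-sumOf : (as : List A) (x : K) (f : A → K) →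
                     x *ᴷ sumOf as f ≈ sumOf as (λ a → x *ᴷ f a)
  *-distribˡ-sumOf []       x f = zeroʳ x
  *-distribˡ-sumOf (a ∷ as) x f = ≈-trans (distribˡ x _ _) (+-congˡ (*-distribˡ-sumOf as x f))

  *-distribʳ-sumOf : (as : List A) (x : K) (f : A → K) →
                     sumOf as f *ᴷ x ≈ sumOf as (λ a → f a *ᴷ x)
  *-distribʳ-sumOf []       x f = zeroˡ x
  *-distribʳ-sumOf (a ∷ as) x f = ≈-trans (distribʳ x _ _) (+-congˡ (*-distribʳ-sumOf as x f))

  sumOf-swap : {B : Set q} (as : List A) (bs : List B) (f : A → B → K) →
               sumOf as (λ a → sumOf bs (f a)) ≈ sumOf bs (λ b → sumOf as (λ a → f a b))
  sumOf-swap []       bs f = ≈-sym (sumOf-zero bs λ _ → ≈-refl)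
  sumOf-swap (a ∷ as) bs f = ≈-trans (+-congˡ (sumOf-swap as bs f)) (≈-sym (sumOf-+ bs (f a) _))

  sumOf-filter : {P : A → Set p} (P? : U.Decidable P) (as : List A) (f : A → K) →
                 sumOf (filter P? as) f ≈ sumOf as (λ a → 𝟙 (P? a) *ᴷ f a)
  sumOf-filter P? []       f = ≈-refl
  sumOf-filter P? (a ∷ as) f with P? a
  ... | yes _ = +-cong (≈-sym (*-identityˡ _)) (sumOf-filter P? as f)
  ... | no  _ = ≈-trans (≈-sym (+-identityˡ _)) (+-cong (≈-sym (zeroˡ _)) (sumOf-filter P? as f))

  -- An indicator with the single solution `w` acts as a Kronecker delta: `w` occurs once in the
  -- list, and all other terms are zero.
  sumOf-unique : {P : A → Set p} (P? : U.Decidable P) {as : List A} {w : A} (f : A → K) →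
                 Unique as → w ∈ as → P w → (∀ {a} → P a → w ≡ a) →
                 sumOf as (λ a → 𝟙 (P? a) *ᴷ f a) ≈ f w
  sumOf-unique P? {as = w ∷ as} f (w∉ ∷ _) (here refl) Pw P⇒≡ =
    ≈-trans (+-cong (𝟙-identityˡ (P? w) Pw) (rest as w∉)) (+-identityʳ _)
    where
    rest : ∀ as → All (λ b → ¬ (w ≡ b)) as → sumOf as (λ a → 𝟙 (P? a) *ᴷ f a) ≈ 0#
    rest []       []         = ≈-refl
    rest (b ∷ as) (w≢b ∷ w∉) =
      ≈-trans (+-cong (𝟙-zeroˡ (P? b) (w≢b ∘ P⇒≡)) (rest as w∉)) (+-identityˡ _)
  sumOf-unique P? {as = b ∷ as} f (b∉ ∷ u) (there w∈) Pw P⇒≡ =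
    ≈-trans (+-cong (𝟙-zeroˡ (P? b) (λ Pb → All.lookup b∉ w∈ (sym (P⇒≡ Pb))))
                    (sumOf-unique P? f u w∈ Pw P⇒≡))
            (+-identityˡ _)

-- The Möbius recursion, freed from accessibility proofs.

_when_ : {P : Set p} → ℤ → Dec P → ℤ
z when (yes _) = z
z when (no _)  = 0ℤ

module MöbiusRecursion {a ℓ₁ ℓ₂ : Level} (P : DecPoset a ℓ₁ ℓ₂)
         (elements : List (DecPoset.Carrier P))
         (<-wf : WellFounded (Strict._<_ (DecPoset._≈_ P) (DecPoset._≤_ P)))
         where
  open Möbius P elements <-wf
  private
    module P = DecPoset P
  _⊏_ : P.Carrier → P.Carrier → Set _
  _⊏_ = Strict._<_ P._≈_ P._≤_
  _⊏?_ : ∀ x y → Dec (x ⊏ y)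
  _⊏?_ = Strict.<-decidable P._≈_ P._≤_ P._≟_ P._≤?_

  -- The summands of μ-acc come from a local function of Möbius; unification recovers the step.
  step : ∀ x y (rs : ∀ {z} → z ⊏ y → Acc _⊏_ z) →
         Σ[ f ∈ (P.Carrier → ℤ → ℤ) ]
           μ-acc x y (acc rs) ≡ (if does (x P.≟ y) then 1ℤ else ℤ.- foldr f 0ℤ elements)
  step x y rs = _ , refl

  -- By induction on accessibility: the two unfoldings differ only in the proofs passed to the
  -- recursive calls.
  μ-acc-irrelevant : ∀ x y (r s : Acc _⊏_ y) → μ-acc x y r ≡ μ-acc x y s
  μ-acc-irrelevant x y (acc rs) (acc ss) =
    cong (λ s → if does (x P.≟ y) then 1ℤ else ℤ.- s) (foldr-cong step-≡ refl elements)
    where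
    step-≡ : ∀ z s → proj₁ (step x y rs) z s ≡ proj₁ (step x y ss) z s
    -- Matching on the decision makes the hidden summands on both sides reduce.
    step-≡ z s with (x P.≤? z) ×-dec (z ⊏? y)
    ... | yes (_ , z⊏y) = cong (ℤ._+ s) (μ-acc-irrelevant x z (rs z⊏y) (ss z⊏y))
    ... | no _          = refl

  -- `_when_` mirrors the local function `term` of `Möbius`. Unfolding yields recursive calls at
  -- `rs z⊏y`, which irrelevance exchanges for `<-wf z`.
  μ-recursion : ∀ x y → μ x y ≡
    (if does (x P.≟ y) then 1ℤ
     else ℤ.- foldr (λ z s → (μ x z when ((x P.≤? z) ×-dec (z ⊏? y))) ℤ.+ s) 0ℤ elements)
  μ-recursion x y with <-wf y
  ... | acc rs =
    cong (λ s → if does (x P.≟ y) then 1ℤ else ℤ.- s) (foldr-cong step-≡ refl elements)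
    where
    step-≡ : ∀ z s → proj₁ (step x y rs) z s ≡
                     (μ x z when ((x P.≤? z) ×-dec (z ⊏? y))) ℤ.+ s
    step-≡ z s with (x P.≤? z) ×-dec (z ⊏? y)
    ... | yes (_ , z⊏y) = cong (ℤ._+ s) (μ-acc-irrelevant x z (rs z⊏y) (<-wf z))
    ... | no _          = refl

  μ-≈ : ∀ {x y} → x P.≈ y → μ x y ≡ 1ℤ
  μ-≈ {x} {y} x≈y rewrite μ-recursion x y | dec-true (x P.≟ y) x≈y = refl

  μ-≉ : ∀ {x y} → ¬ (x P.≈ y) →
        μ x y ≡ ℤ.- foldr (λ z s → (μ x z when ((x P.≤? z) ×-dec (z ⊏? y))) ℤ.+ s) 0ℤ elements
  μ-≉ {x} {y} x≉y rewrite μ-recursion x y | dec-false (x P.≟ y) x≉y = refl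

-- Additivity of the map from the integers to the field.

fieldRing : ∀ {c ℓ₁ ℓ₂} → HeytingField c ℓ₁ ℓ₂ → CommutativeRing c ℓ₁
fieldRing K = HeytingCommutativeRing.commutativeRing (HeytingField.heytingCommutativeRing K)

module FromℤProperties {c ℓ₁ ℓ₂} (K : HeytingField c ℓ₁ ℓ₂) where
  open FieldDefs K using (fromℤ)
  open CommutativeRing (fieldRing K)
    renaming (_+_ to _+ᴷ_; _*_ to _*ᴷ_; -_ to -ᴷ_; refl to ≈-refl; sym to ≈-sym; trans to ≈-trans)
  open RingProperties ring using (-0#≈0#; -‿involutive; -‿+-comm)
  open CommutativeSemigroupProperties +-commutativeSemigroup
    using () renaming (interchange to +-interchange)
  open MonoidMult +-monoid using (×-homo-+) renaming (_×_ to _×ᴷ_)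
  open IndicatorSums (fieldRing K)
  open import Relation.Binary.Reasoning.Setoid setoid

  -- Integer addition with mixed signs computes to `⊖`, so additivity rests on this case. The
  -- induction step inserts `1# +ᴷ -ᴷ 1#` and gives one unit to each multiple.
  fromℤ-⊖ : ∀ m n → fromℤ (m ℤ.⊖ n) ≈ m ×ᴷ 1# +ᴷ -ᴷ (n ×ᴷ 1#)
  fromℤ-⊖ zero    zero    = ≈-sym (-‿inverseʳ 0#)
  fromℤ-⊖ zero    (suc n) = ≈-sym (+-identityˡ _)
  fromℤ-⊖ (suc m) zero    = ≈-sym (≈-trans (+-congˡ -0#≈0#) (+-identityʳ _))
  fromℤ-⊖ (suc m) (suc n) = begin
    fromℤ (suc m ℤ.⊖ suc n)                           ≡⟨ cong fromℤ (ℤ.[1+m]⊖[1+n]≡m⊖n m n) ⟩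
    fromℤ (m ℤ.⊖ n)                                   ≈⟨ fromℤ-⊖ m n ⟩
    m ×ᴷ 1# +ᴷ -ᴷ (n ×ᴷ 1#)                           ≈⟨ +-identityˡ _ ⟨
    0# +ᴷ (m ×ᴷ 1# +ᴷ -ᴷ (n ×ᴷ 1#))                   ≈⟨ +-congʳ (-‿inverseʳ 1#) ⟨
    (1# +ᴷ -ᴷ 1#) +ᴷ (m ×ᴷ 1# +ᴷ -ᴷ (n ×ᴷ 1#))        ≈⟨ +-interchange _ _ _ _ ⟩
    (1# +ᴷ m ×ᴷ 1#) +ᴷ (-ᴷ 1# +ᴷ -ᴷ (n ×ᴷ 1#))        ≈⟨ +-congˡ (-‿+-comm _ _) ⟩
    (1# +ᴷ m ×ᴷ 1#) +ᴷ -ᴷ (1# +ᴷ n ×ᴷ 1#)             ∎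

  fromℤ-homo-neg : ∀ z → fromℤ (ℤ.- z) ≈ -ᴷ fromℤ z
  fromℤ-homo-neg (+ zero)    = ≈-sym -0#≈0#
  fromℤ-homo-neg (+ (suc n)) = ≈-refl
  fromℤ-homo-neg -[1+ n ]    = ≈-sym (-‿involutive _)

  fromℤ-homo-+ : ∀ y z → fromℤ (y ℤ.+ z) ≈ fromℤ y +ᴷ fromℤ z
  fromℤ-homo-+ (+ m)    (+ n)    = ×-homo-+ 1# m n
  fromℤ-homo-+ (+ m)    -[1+ n ] = fromℤ-⊖ m (suc n)
  fromℤ-homo-+ -[1+ m ] (+ n)    = ≈-trans (fromℤ-⊖ n (suc m)) (+-comm _ _)
  fromℤ-homo-+ -[1+ m ] -[1+ n ] = begin
    -ᴷ (suc (suc (m + n)) ×ᴷ 1#)                ≡⟨ cong (λ k → -ᴷ (suc k ×ᴷ 1#)) (ℕ.+-suc m n) ⟨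
    -ᴷ ((suc m + suc n) ×ᴷ 1#)                  ≈⟨ -‿cong (×-homo-+ 1# (suc m) (suc n)) ⟩
    -ᴷ (suc m ×ᴷ 1# +ᴷ suc n ×ᴷ 1#)             ≈⟨ -‿+-comm _ _ ⟨
    -ᴷ (suc m ×ᴷ 1#) +ᴷ -ᴷ (suc n ×ᴷ 1#)        ∎

  fromℤ-sum : (as : List A) (f : A → ℤ) →
              fromℤ (foldr (λ a s → f a ℤ.+ s) 0ℤ as) ≈ sumOf as (λ a → fromℤ (f a))
  fromℤ-sum []       f = ≈-refl
  fromℤ-sum (a ∷ as) f = ≈-trans (fromℤ-homo-+ (f a) _) (+-congˡ (fromℤ-sum as f))

  fromℤ-when : {P : Set p} (z : ℤ) (P? : Dec P) → fromℤ (z when P?) ≈ 𝟙 P? *ᴷ fromℤ z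
  fromℤ-when z (yes _) = ≈-sym (*-identityˡ _)
  fromℤ-when z (no _)  = ≈-sym (zeroˡ _)

-- The zeta transform: injectivity and linearity.

module ZetaTransform {c ℓ₁ ℓ₂} (K : HeytingField c ℓ₁ ℓ₂) (δ : RangeMap) where
  open CliffOperad K δ
  open FieldDefs K using (fromℤ)
  open FromℤProperties K
  open CommutativeRing (fieldRing K)
    renaming (_+_ to _+ᴷ_; _*_ to _*ᴷ_; -_ to -ᴷ_; refl to ≈-refl; sym to ≈-sym; trans to ≈-trans)
  open RingProperties ring using () renaming (+-cancelˡ to +ᴷ-cancelˡ)
  open CommutativeSemigroupProperties *-commutativeSemigroup
    using () renaming (interchange to *-interchange; x∙yz≈y∙xz to *-leftComm)
  open IndicatorSums (fieldRing K)
  open import Relation.Binary.Reasoning.Setoid setoid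

  -- The same term as in `μ≼`, so that the facts of `MöbiusRecursion` apply to `μ≼` by definition.
  ≺-wf : WellFounded (Strict._<_ (λ (x y : Cl δ k) → value x ≡ value y) (λ x y → value x ≼ value y))
  ≺-wf = On.wellFounded value ≺-wellFounded

  open module Cliffs {k} = MöbiusRecursion (cliffPoset δ k) (cliffs δ k) ≺-wf using (μ-≈; μ-≉)
    renaming (_⊏_ to _≺_; _⊏?_ to _≺?_)

  _≟ᶜ_ : (x y : Cl δ k) → Dec (value x ≡ value y)
  x ≟ᶜ y = ≡-dec ℕ._≟_ (value x) (value y)

  _≼ᶜ?_ : (x y : Cl δ k) → Dec (value x ≼ value y)
  x ≼ᶜ? y = value x ≼? value y

  ∑-eval : (as : List A) (f : A → Op k) (w : Cl δ k) → ∑ as f w ≡ sumOf as (λ a → f a w)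
  ∑-eval []       f w = refl
  ∑-eval (a ∷ as) f w = cong (f a w +ᴷ_) (∑-eval as f w)

  ζ : Op k → Cl δ k → Carrier
  ζ {k} x y = sumOf (cliffs δ k) λ z → 𝟙 (z ≼ᶜ? y) *ᴷ x z

  -- Without the diagonal term, this sum serves both the inversion of `ζ` and the Möbius recursion.
  ζ≺ : Op k → Cl δ k → Carrier
  ζ≺ {k} x y = sumOf (cliffs δ k) λ z → 𝟙 (z ≺? y) *ᴷ x z

  sumOf-≡ : (w : Cl δ k) (f : Op k) → sumOf (cliffs δ k) (λ z → 𝟙 (w ≟ᶜ z) *ᴷ f z) ≈ f w
  sumOf-≡ w f = sumOf-unique (w ≟ᶜ_) f (cliffs-unique δ _) (∈-cliffs δ w) refl value-injective

  sumOf-≡′ : (w : Cl δ k) (f : Op k) → sumOf (cliffs δ k) (λ z → 𝟙 (z ≟ᶜ w) *ᴷ f z) ≈ f w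
  sumOf-≡′ w f =
    sumOf-unique (_≟ᶜ w) f (cliffs-unique δ _) (∈-cliffs δ w) refl (value-injective ∘ sym)

  -- `≼` is the disjoint union of `≺` and equality, so their indicators add; equality picks out the
  -- term `x y`.
  ζ-split : (x : Op k) (y : Cl δ k) → ζ x y ≈ ζ≺ x y +ᴷ x y
  ζ-split {k} x y = begin
    ζ x y
      ≈⟨ sumOf-cong (cliffs δ k) (λ z → ≈-trans (*-congʳ (split z)) (distribʳ _ _ _)) ⟩
    sumOf (cliffs δ k) (λ z → 𝟙 (z ≺? y) *ᴷ x z +ᴷ 𝟙 (z ≟ᶜ y) *ᴷ x z)
      ≈⟨ sumOf-+ (cliffs δ k) _ _ ⟩
    ζ≺ x y +ᴷ sumOf (cliffs δ k) (λ z → 𝟙 (z ≟ᶜ y) *ᴷ x z)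
      ≈⟨ +-congˡ (sumOf-≡′ y x) ⟩
    ζ≺ x y +ᴷ x y ∎
    where
    split : ∀ z → 𝟙 (z ≼ᶜ? y) ≈ 𝟙 (z ≺? y) +ᴷ 𝟙 (z ≟ᶜ y)
    split z = go (z ≟ᶜ y)
      where
      go : Dec (value z ≡ value y) → 𝟙 (z ≼ᶜ? y) ≈ 𝟙 (z ≺? y) +ᴷ 𝟙 (z ≟ᶜ y)
      go (yes z≡y) = begin
        𝟙 (z ≼ᶜ? y)
          ≈⟨ 𝟙-true (z ≼ᶜ? y) (subst (value z ≼_) z≡y (Pointwise.refl ℕ.≤-refl)) ⟩
        1#
          ≈⟨ +-identityˡ 1# ⟨
        0# +ᴷ 1#
          ≈⟨ +-cong (𝟙-false (z ≺? y) (λ z≺y → proj₂ z≺y z≡y)) (𝟙-true (z ≟ᶜ y) z≡y) ⟨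
        𝟙 (z ≺? y) +ᴷ 𝟙 (z ≟ᶜ y) ∎
      go (no z≢y) = begin
        𝟙 (z ≼ᶜ? y)                 ≈⟨ 𝟙-⇔ (mk⇔ (λ z≼y → z≼y , z≢y) proj₁) (z ≼ᶜ? y) (z ≺? y) ⟩
        𝟙 (z ≺? y)                  ≈⟨ +-identityʳ _ ⟨
        𝟙 (z ≺? y) +ᴷ 0#            ≈⟨ +-congˡ (𝟙-false (z ≟ᶜ y) z≢y) ⟨
        𝟙 (z ≺? y) +ᴷ 𝟙 (z ≟ᶜ y)    ∎

  -- `ζ` is unitriangular: `x y` is determined by `ζ x y` and the coefficients strictly below `y`,
  -- which agree by well-founded induction.
  ζ-injective : {x x′ : Op k} → ζ x ≋ ζ x′ → x ≋ x′
  ζ-injective {k} {x} {x′} ζ≈ w = go w (≺-wf w)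
    where
    go : ∀ y → Acc _≺_ y → x y ≈ x′ y
    go y (acc rs) = +ᴷ-cancelˡ (ζ≺ x y) _ _ (begin
      ζ≺ x y +ᴷ x y      ≈⟨ ζ-split x y ⟨
      ζ x y              ≈⟨ ζ≈ y ⟩
      ζ x′ y             ≈⟨ ζ-split x′ y ⟩
      ζ≺ x′ y +ᴷ x′ y    ≈⟨ +-congʳ (sumOf-cong (cliffs δ k) λ z →
                              𝟙-congˡ (z ≺? y) λ z≺y → go z (rs z≺y)) ⟨
      ζ≺ x y +ᴷ x′ y     ∎)

  ζ-∑ : (as : List A) (f : A → Op k) (y : Cl δ k) → ζ (∑ as f) y ≈ sumOf as (λ a → ζ (f a) y)
  ζ-∑ {k = k} as f y = begin
    sumOf (cliffs δ k) (λ z → 𝟙 (z ≼ᶜ? y) *ᴷ ∑ as f z)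
      ≈⟨ sumOf-cong (cliffs δ k) (λ z → ≈-trans (*-congˡ (reflexive (∑-eval as f z)))
                                                    (*-distribˡ-sumOf as _ _)) ⟩
    sumOf (cliffs δ k) (λ z → sumOf as λ a → 𝟙 (z ≼ᶜ? y) *ᴷ f a z)
      ≈⟨ sumOf-swap (cliffs δ k) as _ ⟩
    sumOf as (λ a → ζ (f a) y) ∎

  ζ-· : (r : Carrier) (x : Op k) (y : Cl δ k) → ζ (r · x) y ≈ r *ᴷ ζ x y
  ζ-· {k} r x y = begin
    sumOf (cliffs δ k) (λ z → 𝟙 (z ≼ᶜ? y) *ᴷ (r *ᴷ x z))
      ≈⟨ sumOf-cong (cliffs δ k) (λ z → *-leftComm _ _ _) ⟩
    sumOf (cliffs δ k) (λ z → r *ᴷ (𝟙 (z ≼ᶜ? y) *ᴷ x z))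
      ≈⟨ *-distribˡ-sumOf (cliffs δ k) r _ ⟨
    r *ᴷ ζ x y ∎

  ζ-E : (w y : Cl δ k) → ζ (E w) y ≈ 𝟙 (w ≼ᶜ? y)
  ζ-E {k} w y = ≈-trans (sumOf-cong (cliffs δ k) λ z → *-comm _ _) (sumOf-≡ w (λ z → 𝟙 (z ≼ᶜ? y)))

  -- Möbius inversion for the fundamental basis.

  F-coefficient : (w z : Cl δ k) → F w z ≈ 𝟙 (w ≼ᶜ? z) *ᴷ fromℤ (μ≼ δ w z)
  F-coefficient {k} w z = begin
    F w z
      ≡⟨ ∑-eval (filter (w ≼ᶜ?_) (cliffs δ k)) _ z ⟩
    sumOf (filter (w ≼ᶜ?_) (cliffs δ k)) (λ w′ → fromℤ (μ≼ δ w w′) *ᴷ 𝟙 (w′ ≟ᶜ z))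
      ≈⟨ sumOf-filter (w ≼ᶜ?_) (cliffs δ k) _ ⟩
    sumOf (cliffs δ k) (λ w′ → 𝟙 (w ≼ᶜ? w′) *ᴷ (fromℤ (μ≼ δ w w′) *ᴷ 𝟙 (w′ ≟ᶜ z)))
      ≈⟨ sumOf-cong (cliffs δ k) (λ w′ → ≈-trans (≈-sym (*-assoc _ _ _)) (*-comm _ _)) ⟩
    sumOf (cliffs δ k) (λ w′ → 𝟙 (w′ ≟ᶜ z) *ᴷ (𝟙 (w ≼ᶜ? w′) *ᴷ fromℤ (μ≼ δ w w′)))
      ≈⟨ sumOf-≡′ z _ ⟩
    𝟙 (w ≼ᶜ? z) *ᴷ fromℤ (μ≼ δ w z) ∎

  ζ≺-F : (w y : Cl δ k) → ζ≺ (F w) y ≈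
         sumOf (cliffs δ k) (λ z → 𝟙 ((w ≼ᶜ? z) ×-dec (z ≺? y)) *ᴷ fromℤ (μ≼ δ w z))
  ζ≺-F {k} w y = sumOf-cong (cliffs δ k) λ z → begin
    𝟙 (z ≺? y) *ᴷ F w z                                    ≈⟨ *-congˡ (F-coefficient w z) ⟩
    𝟙 (z ≺? y) *ᴷ (𝟙 (w ≼ᶜ? z) *ᴷ fromℤ (μ≼ δ w z))         ≈⟨ *-leftComm _ _ _ ⟩
    𝟙 (w ≼ᶜ? z) *ᴷ (𝟙 (z ≺? y) *ᴷ fromℤ (μ≼ δ w z))         ≈⟨ *-assoc _ _ _ ⟨
    (𝟙 (w ≼ᶜ? z) *ᴷ 𝟙 (z ≺? y)) *ᴷ fromℤ (μ≼ δ w z)         ≈⟨ *-congʳ (𝟙-× (w ≼ᶜ? z) (z ≺? y)) ⟩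
    𝟙 ((w ≼ᶜ? z) ×-dec (z ≺? y)) *ᴷ fromℤ (μ≼ δ w z)        ∎

  fromℤ-μ-≡ : (w : Cl δ k) → fromℤ (μ≼ δ w w) ≈ 1#
  -- `fromℤ 1ℤ` unfolds to `1# +ᴷ 0#`.
  fromℤ-μ-≡ w = ≈-trans (reflexive (cong fromℤ (μ-≈ {x = w} {w} refl))) (+-identityʳ 1#)

  -- The Möbius recursion carried into the field: by `ζ≺-F` its sum is `ζ≺ (F w) y`.
  fromℤ-μ-≢ : (w y : Cl δ k) → ¬ (value w ≡ value y) → fromℤ (μ≼ δ w y) ≈ -ᴷ ζ≺ (F w) y
  fromℤ-μ-≢ {k} w y w≢y = begin
    fromℤ (μ≼ δ w y)
      ≡⟨ cong fromℤ (μ-≉ {x = w} {y} w≢y) ⟩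
    fromℤ (ℤ.- foldr (λ z s → summand z ℤ.+ s) 0ℤ (cliffs δ k))
      ≈⟨ fromℤ-homo-neg (foldr (λ z s → summand z ℤ.+ s) 0ℤ (cliffs δ k)) ⟩
    -ᴷ fromℤ (foldr (λ z s → summand z ℤ.+ s) 0ℤ (cliffs δ k))
      ≈⟨ -‿cong (fromℤ-sum (cliffs δ k) summand) ⟩
    -ᴷ sumOf (cliffs δ k) (λ z → fromℤ (summand z))
      ≈⟨ -‿cong (sumOf-cong (cliffs δ k) λ z → fromℤ-when (μ≼ δ w z) ((w ≼ᶜ? z) ×-dec (z ≺? y))) ⟩
    -ᴷ sumOf (cliffs δ k) (λ z → 𝟙 ((w ≼ᶜ? z) ×-dec (z ≺? y)) *ᴷ fromℤ (μ≼ δ w z))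
      ≈⟨ -‿cong (ζ≺-F w y) ⟨
    -ᴷ ζ≺ (F w) y ∎
    where
    summand : Cl δ k → ℤ
    summand z = μ≼ δ w z when ((w ≼ᶜ? z) ×-dec (z ≺? y))

  ζ≺-F-zero : (w y : Cl δ k) → (∀ z → value w ≼ value z → ¬ (z ≺ y)) → ζ≺ (F w) y ≈ 0#
  ζ≺-F-zero {k} w y none = ≈-trans (ζ≺-F w y) (sumOf-zero (cliffs δ k) λ z →
    𝟙-zeroˡ ((w ≼ᶜ? z) ×-dec (z ≺? y)) λ (w≼z , z≺y) → none z w≼z z≺y)

  ζ-F : (w y : Cl δ k) → ζ (F w) y ≈ 𝟙 (w ≟ᶜ y)
  ζ-F {k} w y = ≈-trans (ζ-split (F w) y) (go (w ≟ᶜ y) (w ≼ᶜ? y))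
    where
    open DecPoset (cliffPoset δ k) using (antisym) renaming (trans to ≼-trans)
    go : Dec (value w ≡ value y) → Dec (value w ≼ value y) → ζ≺ (F w) y +ᴷ F w y ≈ 𝟙 (w ≟ᶜ y)
    -- No `z` satisfies `w ≼ z ≺ w`, so only the diagonal coefficient remains.
    go (yes w≡y) _ with refl ← value-injective {v = w} {y} w≡y = begin
      ζ≺ (F w) w +ᴷ F w w
        ≈⟨ +-cong (ζ≺-F-zero w w λ z w≼z (z≼w , z≢w) → z≢w (antisym {z} {w} z≼w w≼z))
                  (F-coefficient w w) ⟩
      0# +ᴷ 𝟙 (w ≼ᶜ? w) *ᴷ fromℤ (μ≼ δ w w)
        ≈⟨ +-identityˡ _ ⟩
      𝟙 (w ≼ᶜ? w) *ᴷ fromℤ (μ≼ δ w w)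
        ≈⟨ 𝟙-identityˡ (w ≼ᶜ? w) (Pointwise.refl ℕ.≤-refl) ⟩
      fromℤ (μ≼ δ w w)
        ≈⟨ fromℤ-μ-≡ w ⟩
      1#
        ≈⟨ 𝟙-true (w ≟ᶜ w) refl ⟨
      𝟙 (w ≟ᶜ w) ∎
    -- By the recursion, the diagonal coefficient is minus the strict sum.
    go (no w≢y) (yes w≼y) = begin
      ζ≺ (F w) y +ᴷ F w y
        ≈⟨ +-congˡ (≈-trans (F-coefficient w y) (𝟙-identityˡ (w ≼ᶜ? y) w≼y)) ⟩
      ζ≺ (F w) y +ᴷ fromℤ (μ≼ δ w y)
        ≈⟨ +-congˡ (fromℤ-μ-≢ w y w≢y) ⟩
      ζ≺ (F w) y +ᴷ -ᴷ ζ≺ (F w) y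
        ≈⟨ -‿inverseʳ _ ⟩
      0#
        ≈⟨ 𝟙-false (w ≟ᶜ y) w≢y ⟨
      𝟙 (w ≟ᶜ y) ∎
    -- A `z` with `w ≼ z ≼ y` would force `w ≼ y`, so both terms vanish.
    go (no w≢y) (no w⋠y) = begin
      ζ≺ (F w) y +ᴷ F w y
        ≈⟨ +-cong (ζ≺-F-zero w y λ z w≼z (z≼y , _) → w⋠y (≼-trans {w} {z} {y} w≼z z≼y))
                  (≈-trans (F-coefficient w y) (𝟙-zeroˡ (w ≼ᶜ? y) w⋠y)) ⟩
      0# +ᴷ 0#
        ≈⟨ +-identityˡ 0# ⟩
      0#
        ≈⟨ 𝟙-false (w ≟ᶜ y) w≢y ⟨
      𝟙 (w ≟ᶜ y) ∎

  -- The transform of a composition, and the product formula.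

  ζ-E∘ : (u : Cl δ m) (i : Fin (suc m)) (v : Cl δ n) (y : Cl δ (m + n)) →
         ζ (E∘ u i v) y ≈
         𝟙 (u ≼ᶜ? truncate δ (outer i n) (value y)) *ᴷ 𝟙 (v ≼ᶜ? truncate δ (inner i) (value y))
  ζ-E∘ {m} {n} u i v y = ≈-trans □-step
    (≈-trans (𝟙-⇔ (□-≼ δ u i v (value y)) (value u □⟨ i ⟩ value v ≼? value y) (u≼? ×-dec v≼?))
             (≈-sym (𝟙-× u≼? v≼?)))
    where
    u≼? = u ≼ᶜ? truncate δ (outer i n) (value y)
    v≼? = v ≼ᶜ? truncate δ (inner i) (value y)
    □-step : ζ (E∘ u i v) y ≈ 𝟙 (value u □⟨ i ⟩ value v ≼? value y)
    □-step with isCliff? δ (value u □⟨ i ⟩ value v)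
    ... | yes c = ζ-E (value u □⟨ i ⟩ value v , [ c ]) y
    -- Cliffs are closed downwards: no cliff lies above a word that is not one, so both sides are
    -- zero.
    ... | no ¬c = ≈-trans (sumOf-zero (cliffs δ (m + n)) λ z → zeroʳ _)
      (≈-sym (𝟙-false (value u □⟨ i ⟩ value v ≼? value y) λ le → ¬c (≼-cliff δ le (isCliff δ y))))

  -- By `ζ-E∘` each summand is a factor depending on `u` times a factor depending on `v`, so the
  -- double sum is a product of two sums.
  ζ-∘ : (x : Op m) (i : Fin (suc m)) (x′ : Op n) (y : Cl δ (m + n)) →
        ζ (x ∘⟨ i ⟩ x′) y ≈
        ζ x (truncate δ (outer i n) (value y)) *ᴷ ζ x′ (truncate δ (inner i) (value y))
  ζ-∘ {m} {n} x i x′ y = begin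
    ζ (x ∘⟨ i ⟩ x′) y
      ≈⟨ ζ-∑ (cliffs δ m) _ y ⟩
    sumOf (cliffs δ m) (λ u → ζ (∑ (cliffs δ n) λ v → (x u *ᴷ x′ v) · E∘ u i v) y)
      ≈⟨ sumOf-cong (cliffs δ m) (λ u → ζ-∑ (cliffs δ n) _ y) ⟩
    sumOf (cliffs δ m) (λ u → sumOf (cliffs δ n) λ v → ζ ((x u *ᴷ x′ v) · E∘ u i v) y)
      ≈⟨ sumOf-cong (cliffs δ m) (λ u → sumOf-cong (cliffs δ n) (summand-≈ u)) ⟩
    sumOf (cliffs δ m) (λ u → sumOf (cliffs δ n) λ v →
      (𝟙 (u ≼ᶜ? yₒ) *ᴷ x u) *ᴷ (𝟙 (v ≼ᶜ? yᵢ) *ᴷ x′ v))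
      ≈⟨ sumOf-cong (cliffs δ m) (λ u → *-distribˡ-sumOf (cliffs δ n) _ _) ⟨
    sumOf (cliffs δ m) (λ u → (𝟙 (u ≼ᶜ? yₒ) *ᴷ x u) *ᴷ ζ x′ yᵢ)
      ≈⟨ *-distribʳ-sumOf (cliffs δ m) _ _ ⟨
    ζ x yₒ *ᴷ ζ x′ yᵢ ∎
    where
    yₒ = truncate δ (outer i n) (value y)
    yᵢ = truncate δ (inner i) (value y)
    summand-≈ : ∀ u v → ζ ((x u *ᴷ x′ v) · E∘ u i v) y ≈
                (𝟙 (u ≼ᶜ? yₒ) *ᴷ x u) *ᴷ (𝟙 (v ≼ᶜ? yᵢ) *ᴷ x′ v)
    summand-≈ u v = begin
      ζ ((x u *ᴷ x′ v) · E∘ u i v) y                              ≈⟨ ζ-· _ (E∘ u i v) y ⟩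
      (x u *ᴷ x′ v) *ᴷ ζ (E∘ u i v) y                             ≈⟨ *-comm _ _ ⟩
      ζ (E∘ u i v) y *ᴷ (x u *ᴷ x′ v)                             ≈⟨ *-congʳ (ζ-E∘ u i v y) ⟩
      (𝟙 (u ≼ᶜ? yₒ) *ᴷ 𝟙 (v ≼ᶜ? yᵢ)) *ᴷ (x u *ᴷ x′ v)             ≈⟨ *-interchange _ _ _ _ ⟩
      (𝟙 (u ≼ᶜ? yₒ) *ᴷ x u) *ᴷ (𝟙 (v ≼ᶜ? yᵢ) *ᴷ x′ v)             ∎

  -- Each `F w` contributes the indicator of `w`, and these add up to the indicator of the interval.
  ζ-∑-interval-F : (a b : Word k) (y : Cl δ k) →
                   ζ (∑ (interval δ a b) F) y ≈ 𝟙 ((a ≼? value y) ×-dec (value y ≼? b))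
  ζ-∑-interval-F {k} a b y = begin
    ζ (∑ (interval δ a b) F) y
      ≈⟨ ζ-∑ (interval δ a b) F y ⟩
    sumOf (interval δ a b) (λ w → ζ (F w) y)
      ≈⟨ sumOf-cong (interval δ a b) (λ w → ζ-F w y) ⟩
    sumOf (interval δ a b) (λ w → 𝟙 (w ≟ᶜ y))
      ≈⟨ sumOf-filter (λ w → (a ≼? value w) ×-dec (value w ≼? b)) (cliffs δ k) _ ⟩
    sumOf (cliffs δ k) (λ w → 𝟙 ((a ≼? value w) ×-dec (value w ≼? b)) *ᴷ 𝟙 (w ≟ᶜ y))
      ≈⟨ sumOf-cong (cliffs δ k) (λ w → *-comm _ _) ⟩
    sumOf (cliffs δ k) (λ w → 𝟙 (w ≟ᶜ y) *ᴷ 𝟙 ((a ≼? value w) ×-dec (value w ≼? b)))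
      ≈⟨ sumOf-≡′ y _ ⟩
    𝟙 ((a ≼? value y) ×-dec (value y ≼? b)) ∎

  F-∘-F : (u : Cl δ m) (v : Cl δ n) (i : Fin (suc m)) →
        F u ∘⟨ i ⟩ F v
          ≋ χ (value u □⟨ i ⟩ value v)
            · ∑ (interval δ (value u □⟨ i ⟩ value v) (value u ■⟨ δ , i ⟩ value v)) F
  F-∘-F {m} {n} u v i = ζ-injective λ y →
    let a = value u □⟨ i ⟩ value v
        b = value u ■⟨ δ , i ⟩ value v
        yₒ = truncate δ (outer i n) (value y)
        yᵢ = truncate δ (inner i) (value y)
        a≼y≼b? = (a ≼? value y) ×-dec (value y ≼? b)
    in begin
    ζ (F u ∘⟨ i ⟩ F v) y                       ≈⟨ ζ-∘ (F u) i (F v) y ⟩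
    ζ (F u) yₒ *ᴷ ζ (F v) yᵢ                   ≈⟨ *-cong (ζ-F u yₒ) (ζ-F v yᵢ) ⟩
    𝟙 (u ≟ᶜ yₒ) *ᴷ 𝟙 (v ≟ᶜ yᵢ)                 ≈⟨ 𝟙-× (u ≟ᶜ yₒ) (v ≟ᶜ yᵢ) ⟩
    𝟙 ((u ≟ᶜ yₒ) ×-dec (v ≟ᶜ yᵢ))              ≈⟨ 𝟙-⇔ (≡-truncate⇔∈interval δ u i v y)
                                                      ((u ≟ᶜ yₒ) ×-dec (v ≟ᶜ yᵢ)) a≼y≼b? ⟩
    𝟙 a≼y≼b?                                   ≈⟨ *-identityʳ _ ⟨
    -- A word below the cliff `y` is itself a cliff, so `χ a` is 1 wherever the indicator is
    -- nonzero.
    𝟙 a≼y≼b? *ᴷ 1#                             ≈⟨ 𝟙-congˡ a≼y≼b? (λ (a≼y , _) →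
                                                    𝟙-true (isCliff? δ a)
                                                      (≼-cliff δ a≼y (isCliff δ y))) ⟨
    𝟙 a≼y≼b? *ᴷ χ a                            ≈⟨ *-comm _ _ ⟩
    χ a *ᴷ 𝟙 a≼y≼b?                            ≈⟨ *-congˡ (ζ-∑-interval-F a b y) ⟨
    χ a *ᴷ ζ (∑ (interval δ a b) F) y          ≈⟨ ζ-· (χ a) (∑ (interval δ a b) F) y ⟨
    ζ (χ a · ∑ (interval δ a b) F) y           ∎

proposition2p2p3 : {c ℓ₁ ℓ₂ : Level} (K : HeytingField c ℓ₁ ℓ₂) → CharacteristicZero K →
    (δ : RangeMap) → Unimodal δ →
    let open CliffOperad K δ in
    {m n : ℕ} (u : Cl δ m) (v : Cl δ n) (i : Fin (suc m)) →
    F u ∘⟨ i ⟩ F v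
    ≋ χ (value u □⟨ i ⟩ value v)
    · ∑ (interval δ (value u □⟨ i ⟩ value v) (value u ■⟨ δ , i ⟩ value v)) F
proposition2p2p3 K _ δ _ u v i = ZetaTransform.F-∘-F K δ u v i
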